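{- For any weighted grid of width $\omega$ there exists another weighted grid of the same width $\omega$ and of depth at most $\frac{\omega^5}{4}$ such that the distances between vertices in the first row of the original grid are preserved; that is, for all $1\le i\le j\le\omega$, the distance between the $i$-th and the $j$-th vertex of the first row is the same in the two grids.
   Context: A grid of width $\omega$ and depth (length) $\ell$ is the complete grid graph with $\ell$ rows of $\omega$ vertices each, with edges exactly between horizontally or vertically adjacent vertices. A weighted grid carries a non-negative weight on every edge. The distance between two vertices is the minimum total weight of a path between them within the given grid.
   Formalization: The width ω is assumed to be at least 2: for ω = 1 the bound ω^5/4 = 1/4 leaves no row, so the claim fails as stated, and for ω = 0 there is nothing to state. -}

module Defs where

open import Level using (Level; _⊔_) renaming (suc to lsuc)
open import Algebra.Core using (Op₁; Op₂)
open import Algebra.Structures using (IsCommutativeRing)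
open import Data.Fin.Base using (Fin; zero; suc; inject₁)
open import Data.List.Base using (List; []; _∷_)
open import Data.List.Relation.Unary.Unique.Propositional using (Unique)
open import Data.Nat.Base using (ℕ; suc)
open import Data.Product.Base using (∃-syntax; _×_; _,_)
open import Relation.Binary.Core using (Rel)
open import Relation.Binary.Structures using (IsTotalOrder)
open import Relation.Nullary.Negation.Core using (¬_)

-- Stands in for the real numbers, which the standard library does not have.
record OrderedField (c ℓ₁ ℓ₂ : Level) : Set (lsuc (c ⊔ ℓ₁ ⊔ ℓ₂)) where
  infix  8 -_
  infixl 7 _*_
  infixl 6 _+_
  infix  4 _≈_ _≤_
  field
    Carrier           : Set c
    _≈_               : Rel Carrier ℓ₁
    _≤_               : Rel Carrier ℓ₂
    _+_ _*_           : Op₂ Carrier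
    -_                : Op₁ Carrier
    0# 1#             : Carrier
    isCommutativeRing : IsCommutativeRing _≈_ _+_ _*_ -_ 0# 1#
    0≉1               : ¬ (0# ≈ 1#)
    inverse           : ∀ x → ¬ (x ≈ 0#) → ∃[ y ] x * y ≈ 1#
    isTotalOrder      : IsTotalOrder _≈_ _≤_
    +-monoˡ-≤         : ∀ z {x y} → x ≤ y → x + z ≤ y + z
    *-nonNegative     : ∀ {x y} → 0# ≤ x → 0# ≤ y → 0# ≤ x * y

-- (row , column), rows and columns counted from 0; ω is the width (number of
-- columns) and ℓ the depth (number of rows).
Vertex : ℕ → ℕ → Set
Vertex ω ℓ = Fin ℓ × Fin ω

data Edge : ℕ → ℕ → Set where
  horizontal : ∀ {ω ℓ} → Fin ℓ → Fin ω → Edge (suc ω) ℓ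
  vertical   : ∀ {ω ℓ} → Fin ℓ → Fin ω → Edge ω (suc ℓ)

-- Each edge is undirected: it joins its two ends in both orders.
data Joins : ∀ {ω ℓ} → Edge ω ℓ → Vertex ω ℓ → Vertex ω ℓ → Set where
  rightward : ∀ {ω ℓ} (r : Fin ℓ) (c : Fin ω) →
              Joins (horizontal r c) (r , inject₁ c) (r , suc c)
  leftward  : ∀ {ω ℓ} (r : Fin ℓ) (c : Fin ω) →
              Joins (horizontal r c) (r , suc c) (r , inject₁ c)
  downward  : ∀ {ω ℓ} (r : Fin ℓ) (c : Fin ω) →
              Joins (vertical r c) (inject₁ r , c) (suc r , c)
  upward    : ∀ {ω ℓ} (r : Fin ℓ) (c : Fin ω) →
              Joins (vertical r c) (suc r , c) (inject₁ r , c)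

data Walk {ω ℓ : ℕ} : Vertex ω ℓ → Vertex ω ℓ → Set where
  stop : ∀ {v} → Walk v v
  step : ∀ {u v w} (e : Edge ω ℓ) → Joins e u v → Walk v w → Walk u w

vertices : ∀ {ω ℓ} {u v : Vertex ω ℓ} → Walk u v → List (Vertex ω ℓ)
vertices {u = u} stop         = u ∷ []
vertices {u = u} (step _ _ p) = u ∷ vertices p

IsPath : ∀ {ω ℓ} {u v : Vertex ω ℓ} → Walk u v → Set
IsPath p = Unique (vertices p)

firstRow : ∀ {ω h} → Fin ω → Vertex ω (suc h)
firstRow i = zero , i

module _ {c ℓ₁ ℓ₂} (F : OrderedField c ℓ₁ ℓ₂) where
  open OrderedField F

  record WeightedGrid (ω ℓ : ℕ) : Set (c ⊔ ℓ₂) where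
    field
      weight      : Edge ω ℓ → Carrier
      nonNegative : ∀ e → 0# ≤ weight e

  module _ {ω ℓ : ℕ} (G : WeightedGrid ω ℓ) where
    open WeightedGrid G

    totalWeight : {u v : Vertex ω ℓ} → Walk u v → Carrier
    totalWeight stop         = 0#
    totalWeight (step e _ p) = weight e + totalWeight p

    IsDistance : Vertex ω ℓ → Vertex ω ℓ → Carrier → Set (ℓ₁ ⊔ ℓ₂)
    IsDistance u v d =
        (∃[ p ] IsPath {u = u} {v = v} p × totalWeight p ≈ d)
      × (∀ (p : Walk u v) → IsPath p → d ≤ totalWeight p)

  -- The common value is unique up to _≈_, since _≤_ is antisymmetric.
  SameDistance : ∀ {ω ℓ ℓ′} → WeightedGrid ω ℓ → WeightedGrid ω ℓ′ →
                 (u v : Vertex ω ℓ) (u′ v′ : Vertex ω ℓ′) → Set (c ⊔ ℓ₁ ⊔ ℓ₂)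
  SameDistance G G′ u v u′ v′ = ∃[ d ] IsDistance G u v d × IsDistance G′ u′ v′ d

module Submission where

-- Write d for the distances of G within its first row.  Since d(i,k) and d(j,l)
-- with i ≤ j ≤ k ≤ l are attained by walks that share a vertex, d satisfies
--   d(i,j) + d(k,l) ≤ d(i,k) + d(j,l)  and  d(i,l) + d(j,k) ≤ d(i,k) + d(j,l).
-- Conversely every such d is realised by an ω × ω grid.  With m = ω - 1, the
-- vertex in row r and column c is labelled (a , b) = (r ⊔ c , c), and an edge gets
-- weight
--   ½ [d(b,a′) - d(b,a) + d(a,m) - d(a′,m)]  when a increases to a′,
--   ½ [d(b,a) - d(b′,a) + d(b′,m) - d(b,m)]  when b increases to b′,
-- or the sum of the two when both do.  Both are non-negative by the inequalities
-- above.  Going down column i to row j, right to column j and back up costs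
-- d(i,j), and no walk is cheaper because the distance from the terminal s is
-- given by an explicit potential.

open import Defs
open import Algebra.Bundles using (CommutativeRing)
open import Algebra.Properties.Ring using (-1*x≈-x)
open import Data.Bool.Base using (Bool; true; false; _∧_; _xor_)
open import Data.Bool.Properties using (xor-same; xor-comm; xor-identityʳ; T-≡)
open import Data.Bool.Solver using (module xor-∧-Solver)
open import Data.Empty using (⊥)
open import Data.Fin.Base as Fin using (Fin; zero; suc; toℕ; inject₁; combine)
open import Data.Fin.Induction using (<-weakInduction; <-weakInduction-startingFrom)
open import Data.List.Base
  using (List; []; _∷_; _++_; length; lookup; map; concatMap; allFin; cartesianProductWith)
open import Data.List.Membership.Propositional using (_∈_; _∉_; find)
open import Data.List.Membership.Propositional.Properties
  using (∈-++⁺ˡ; ∈-++⁺ʳ; ∈-map⁺; ∈-concatMap⁺; ∈-cartesianProductWith⁺; ∈-allFin; ∈-lookup)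
open import Data.List.Relation.Unary.All as All using ([]; _∷_)
open import Data.List.Relation.Unary.All.Properties using (¬Any⇒All¬)
open import Data.List.Relation.Unary.AllPairs using ([]; _∷_)
open import Data.List.Relation.Unary.Any as Any using (here; there)
open import Data.List.Relation.Unary.Unique.Propositional using (Unique)
open import Data.Nat.Base as ℕ using (ℕ; zero; suc; z≤n; s≤s; _⊔_; _⊓_; _≡ᵇ_; _<ᵇ_)
open import Data.Product.Base using (Σ-syntax; ∃-syntax; ∃₂; _×_; _,_; proj₁; proj₂; swap)
open import Data.Product.Properties using (≡-dec)
open import Data.Sum.Base using (_⊎_; inj₁; inj₂)
open import Function.Base using (_∘_; _$_)
open import Function.Bundles using (module Equivalence)
open import Relation.Binary.Bundles using (TotalOrder)
open import Relation.Binary.Definitions using (DecidableEquality)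
open import Relation.Binary.PropositionalEquality
  using (_≡_; _≢_; refl; sym; trans; cong; cong₂; subst; subst₂; module ≡-Reasoning)
open import Relation.Nullary.Decidable using (yes; no)
open import Relation.Nullary.Negation.Core using (¬_; contradiction)
import Algebra.Properties.Group
import Algebra.Solver.CommutativeMonoid
import Data.Fin.Properties as Fin
import Data.List.Extrema
import Data.Nat.Properties as ℕ
import Relation.Binary.Reasoning.Setoid

-- Arithmetic in ordered fields

module Arithmetic {c ℓ₁ ℓ₂} (F : OrderedField c ℓ₁ ℓ₂) where
  open OrderedField F public hiding (isCommutativeRing; isTotalOrder)

  commutativeRing : CommutativeRing c ℓ₁
  commutativeRing = record { isCommutativeRing = OrderedField.isCommutativeRing F }

  open CommutativeRing commutativeRing public
    using ( ring; +-commutativeMonoid; +-cong; +-congˡ; +-congʳ; +-assoc; +-comm; +-identityˡ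
          ; +-identityʳ; -‿inverseʳ; *-identityˡ; distribʳ; *-congʳ)
    renaming (refl to ≈-refl; sym to ≈-sym; trans to ≈-trans; setoid to ≈-setoid)

  totalOrder : TotalOrder c ℓ₁ ℓ₂
  totalOrder = record { isTotalOrder = OrderedField.isTotalOrder F }

  open TotalOrder totalOrder public
    using (total; antisym; ≤-respʳ-≈; ≤-respˡ-≈)
    renaming (refl to ≤-refl; trans to ≤-trans; reflexive to ≤-reflexive)

  private
    module S = Algebra.Solver.CommutativeMonoid +-commutativeMonoid
    module G = Algebra.Properties.Group (CommutativeRing.+-group commutativeRing)
  open S public using (solve; _⊜_; id) renaming (_⊕_ to infixl 6 _⊕_)

  +-monoʳ-≤ : ∀ z {x y} → x ≤ y → z + x ≤ z + y
  +-monoʳ-≤ z x≤y = ≤-respˡ-≈ (+-comm _ z) (≤-respʳ-≈ (+-comm _ z) (+-monoˡ-≤ z x≤y))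

  +-mono-≤ : ∀ {x y z w} → x ≤ y → z ≤ w → x + z ≤ y + w
  +-mono-≤ x≤y z≤w = ≤-trans (+-monoˡ-≤ _ x≤y) (+-monoʳ-≤ _ z≤w)

  +-cancelʳ-≤ : ∀ z {x y} → x + z ≤ y + z → x ≤ y
  +-cancelʳ-≤ z p =
    ≤-respˡ-≈ (G.//-rightDividesʳ z _) (≤-respʳ-≈ (G.//-rightDividesʳ z _) (+-monoˡ-≤ (- z) p))

  +-nonNegative : ∀ {x y} → 0# ≤ x → 0# ≤ y → 0# ≤ x + y
  +-nonNegative 0≤x 0≤y = ≤-respˡ-≈ (+-identityˡ 0#) (+-mono-≤ 0≤x 0≤y)

  x≤y+x : ∀ {x y} → 0# ≤ y → x ≤ y + x
  x≤y+x 0≤y = ≤-respˡ-≈ (+-identityˡ _) (+-monoˡ-≤ _ 0≤y)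

  -- Since `x + r ≈ y + l ≤ y + r`, cancelling `r` suffices. The equation is free of subtraction, so
  -- linear reasoning is left to the commutative monoid solver.
  ≤-from : ∀ {l r x y} → l ≤ r → x + r ≈ y + l → x ≤ y
  ≤-from {r = r} {y = y} l≤r eq =
    +-cancelʳ-≤ r (≤-respˡ-≈ (≈-sym eq) (+-monoʳ-≤ y l≤r))

  ≈-from : ∀ {l r x y} → l ≈ r → x + r ≈ y + l → x ≈ y
  ≈-from {l} {r} {x} {y} l≈r eq = antisym (≤-from (≤-reflexive l≈r) eq)
    (≤-from (≤-reflexive (≈-sym l≈r)) (≈-sym eq))

  double-cancel-≤ : ∀ {x y} → x + x ≤ y + y → x ≤ y
  double-cancel-≤ {x} {y} p with total x y
  ... | inj₁ x≤y = x≤y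
  ... | inj₂ y≤x = +-cancelʳ-≤ x (≤-trans p (+-monoʳ-≤ y y≤x))

  0+0+x≈x : ∀ x → 0# + 0# + x ≈ x
  0+0+x≈x x = ≈-trans (+-congʳ (+-identityˡ 0#)) (+-identityˡ x)

  0≤y-x : ∀ {x y} → x ≤ y → 0# ≤ y + - x
  0≤y-x {x} x≤y = ≤-respˡ-≈ (-‿inverseʳ x) (+-monoˡ-≤ (- x) x≤y)

  0≤1 : 0# ≤ 1#
  0≤1 with total 0# 1#
  ... | inj₁ p = p
  -- Here `- 1#` is non-negative, hence so is its square, which is `1#`.
  ... | inj₂ 1≤0 = ≤-respʳ-≈ (≈-trans (-1*x≈-x ring (- 1#)) (G.⁻¹-involutive 1#))
                     (*-nonNegative 0≤-1 0≤-1)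
    where
    0≤-1 : 0# ≤ - 1#
    0≤-1 = ≤-respʳ-≈ (+-identityˡ _) (0≤y-x 1≤0)

  1≰0 : ¬ (1# ≤ 0#)
  1≰0 p = 0≉1 (antisym 0≤1 p)

  private
    half : ∃[ h ] (1# + 1#) * h ≈ 1#
    -- `1# + 1# ≈ 0#` would force `1# ≤ 0#`, because `1# ≤ 1# + 1#`.
    half = inverse (1# + 1#) (λ 2≈0 → 1≰0 (≤-respʳ-≈ 2≈0 (x≤y+x 0≤1)))

  ½ : Carrier
  ½ = proj₁ half

  ½+½≈1 : ½ + ½ ≈ 1#
  ½+½≈1 = ≈-trans
    (≈-sym (≈-trans (distribʳ ½ 1# 1#) (+-cong (*-identityˡ ½) (*-identityˡ ½)))) (proj₂ half)

  0≤½ : 0# ≤ ½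
  0≤½ = double-cancel-≤ (≤-respʳ-≈ (≈-sym ½+½≈1) (≤-respˡ-≈ (≈-sym (+-identityˡ 0#)) 0≤1))

  -- Supplies the edge weights: `w` is half of `y - x`, in a form without subtraction.
  half-difference : ∀ {x y} → x ≤ y → ∃[ w ] 0# ≤ w × w + w + x ≈ y
  half-difference {x} {y} x≤y = ½ * (y + - x) , *-nonNegative 0≤½ (0≤y-x x≤y) , (begin
    ½ * (y + - x) + ½ * (y + - x) + x  ≈⟨ +-congʳ (distribʳ (y + - x) ½ ½) ⟨
    (½ + ½) * (y + - x) + x            ≈⟨ +-congʳ (*-congʳ ½+½≈1) ⟩
    1# * (y + - x) + x                 ≈⟨ +-congʳ (*-identityˡ _) ⟩
    y + - x + x                        ≈⟨ G.//-rightDividesˡ x y ⟩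
    y                                  ∎)
    where open Relation.Binary.Reasoning.Setoid ≈-setoid

-- Walks and paths

private
  variable
    ω ℓ : ℕ
    e : Edge ω ℓ
    u v w x y : Vertex ω ℓ

_≟ᵥ_ : DecidableEquality (Vertex ω ℓ)
_≟ᵥ_ = ≡-dec Fin._≟_ Fin._≟_

Joins-sym : Joins e u v → Joins e v u
Joins-sym (rightward r c) = leftward r c
Joins-sym (leftward r c)  = rightward r c
Joins-sym (downward r c)  = upward r c
Joins-sym (upward r c)    = downward r c

infixr 5 _∙_

_∙_ : Walk u v → Walk v w → Walk u w
stop       ∙ q = q
step e j p ∙ q = step e j (p ∙ q)

reverse : Walk u v → Walk v u
reverse stop         = stop
reverse (step e j p) = reverse p ∙ step e (Joins-sym j) stop

start∈ : (p : Walk u v) → u ∈ vertices p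
start∈ stop         = here refl
start∈ (step _ _ _) = here refl

end∈ : (p : Walk u v) → v ∈ vertices p
end∈ stop         = here refl
end∈ (step _ _ p) = there (end∈ p)

split : (p : Walk u v) → x ∈ vertices p →
        ∃₂ λ (p₁ : Walk u x) (p₂ : Walk x v) → p ≡ p₁ ∙ p₂
split stop           (here refl) = stop , stop , refl
split (step e j p)   (here refl) = stop , step e j p , refl
split (step e j p)   (there x∈p) =
  let p₁ , p₂ , eq = split p x∈p in step e j p₁ , p₂ , cong (step e j) eq

IsPath-suffix : (p : Walk u v) (q : Walk v w) → IsPath (p ∙ q) → IsPath q
IsPath-suffix stop         q unique       = unique
IsPath-suffix (step _ _ p) q (_ ∷ unique) = IsPath-suffix p q unique

lookup-injective : ∀ {a} {A : Set a} {xs : List A} → Unique xs →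
                   ∀ i j → lookup xs i ≡ lookup xs j → i ≡ j
lookup-injective (_ ∷ _)  zero    zero    _  = refl
lookup-injective (x∉ ∷ _) zero    (suc j) eq = contradiction eq (All.lookup x∉ (∈-lookup j))
lookup-injective (x∉ ∷ _) (suc i) zero    eq = contradiction (sym eq) (All.lookup x∉ (∈-lookup i))
lookup-injective (_ ∷ xs) (suc i) (suc j) eq = cong suc (lookup-injective xs i j eq)

-- Pigeonhole principle: `combine` numbers the vertices by `Fin (ℓ * ω)`, and a path repeats none.
-- The bound makes the search for a lightest walk finite.
path-length : {u v : Vertex ω ℓ} (p : Walk u v) → IsPath p → length (vertices p) ℕ.≤ ℓ ℕ.* ω
path-length p path =
  Fin.injective⇒≤ {f = λ i → let r , c = lookup (vertices p) i in combine r c} λ {i} {j} eq →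
    let r≡ , c≡ = Fin.combine-injective _ _ _ _ eq
    in lookup-injective path i j (cong₂ _,_ r≡ c≡)

-- Enumeration of the walks of bounded length

Step : ℕ → ℕ → Set
Step ω ℓ = ∃[ e ] ∃₂ λ (u v : Vertex ω ℓ) → Joins e u v

edges : ∀ ω ℓ → List (Edge ω ℓ)
edges ω ℓ = horizontals ω ℓ ++ verticals ω ℓ
  where
  horizontals : ∀ ω ℓ → List (Edge ω ℓ)
  horizontals zero    ℓ = []
  horizontals (suc ω) ℓ = cartesianProductWith horizontal (allFin ℓ) (allFin ω)
  verticals : ∀ ω ℓ → List (Edge ω ℓ)
  verticals ω zero    = []
  verticals ω (suc ℓ) = cartesianProductWith vertical (allFin ℓ) (allFin ω)

∈-edges : (e : Edge ω ℓ) → e ∈ edges ω ℓ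
∈-edges (horizontal r c) = ∈-++⁺ˡ (∈-cartesianProductWith⁺ horizontal (∈-allFin r) (∈-allFin c))
∈-edges {ω} {suc ℓ} (vertical r c) = ∈-++⁺ʳ _ (∈-cartesianProductWith⁺ vertical (∈-allFin r) (∈-allFin c))

traversals : Edge ω ℓ → List (Step ω ℓ)
traversals (horizontal r c) = (_ , _ , _ , rightward r c) ∷ (_ , _ , _ , leftward r c) ∷ []
traversals (vertical r c)   = (_ , _ , _ , downward r c) ∷ (_ , _ , _ , upward r c) ∷ []

∈-traversals : (j : Joins e u v) → (e , u , v , j) ∈ traversals e
∈-traversals (rightward r c) = here refl
∈-traversals (leftward r c)  = there (here refl)
∈-traversals (downward r c)  = here refl
∈-traversals (upward r c)    = there (here refl)

steps : ∀ ω ℓ → List (Step ω ℓ)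
steps ω ℓ = concatMap traversals (edges ω ℓ)

-- The number bounds the vertices, not the edges, to match `path-length`.
walks : ℕ → (u v : Vertex ω ℓ) → List (Walk u v)

stops : (u v : Vertex ω ℓ) → List (Walk u v)
stops u v with u ≟ᵥ v
... | yes refl = stop ∷ []
... | no  _    = []

extensions : ℕ → (u v : Vertex ω ℓ) → Step ω ℓ → List (Walk u v)
extensions k u v (e , u′ , w , j) with u ≟ᵥ u′
... | yes refl = map (step e j) (walks k w v)
... | no  _    = []

walks zero    u v = []
walks (suc k) u v = stops u v ++ concatMap (extensions k u v) (steps _ _)

∈-walks : ∀ k (p : Walk u v) → length (vertices p) ℕ.≤ k → p ∈ walks k u v
∈-walks {u = u} (suc k) stop _ = ∈-++⁺ˡ stop∈
  where
  stop∈ : stop ∈ stops u u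
  stop∈ with u ≟ᵥ u
  ... | yes refl = here refl
  ... | no  u≢u  = contradiction refl u≢u
∈-walks {u = u} {v = v} (suc k) (step {v = w} e j p) (s≤s p≤k) =
  ∈-++⁺ʳ (stops u v) (∈-concatMap⁺ (extensions k u v) (Any.map (λ { refl → step∈ }) step∈steps))
  where
  step∈steps : (e , u , w , j) ∈ steps _ _
  step∈steps = ∈-concatMap⁺ traversals (Any.map (λ { refl → ∈-traversals j }) (∈-edges e))
  step∈ : step e j p ∈ extensions k u v (e , u , w , j)
  step∈ with u ≟ᵥ u
  ... | yes refl = ∈-map⁺ (step e j) (∈-walks k p p≤k)
  ... | no  u≢u  = contradiction refl u≢u

-- Distances

module Distance {c ℓ₁ ℓ₂} (F : OrderedField c ℓ₁ ℓ₂) {ω ℓ : ℕ} (G : WeightedGrid F ω ℓ) where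
  open Arithmetic F
  open WeightedGrid G

  weightOf : {u v : Vertex ω ℓ} → Walk u v → Carrier
  weightOf = totalWeight F G

  weightOf-nonNegative : (p : Walk u v) → 0# ≤ weightOf p
  weightOf-nonNegative stop         = ≤-refl
  weightOf-nonNegative (step e _ p) = +-nonNegative (nonNegative e) (weightOf-nonNegative p)

  weightOf-∙ : (p : Walk u v) (q : Walk v w) → weightOf (p ∙ q) ≈ weightOf p + weightOf q
  weightOf-∙ stop         q = ≈-sym (+-identityˡ _)
  weightOf-∙ (step e _ p) q = ≈-trans (+-congˡ (weightOf-∙ p q)) (≈-sym (+-assoc _ _ _))

  weightOf-reverse : (p : Walk u v) → weightOf (reverse p) ≈ weightOf p
  weightOf-reverse stop         = ≈-refl
  weightOf-reverse (step e j p) = ≈-trans (weightOf-∙ (reverse p) _)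
    (≈-trans (+-cong (weightOf-reverse p) (+-identityʳ _)) (+-comm _ _))

  -- If `u` recurs in the loop-free remainder `q`, only the part of `q` from `u` on is kept. Weights
  -- are non-negative, so the dropped part cannot have made the walk lighter.
  eraseLoops : (p : Walk u v) → ∃[ q ] IsPath {u = u} {v} q × weightOf q ≤ weightOf p
  eraseLoops stop = stop , [] ∷ [] , ≤-refl
  eraseLoops {u = u} (step e j p) with eraseLoops p
  ... | q , path , q≤p with Any.any? (u ≟ᵥ_) (vertices q)
  ...   | no  u∉q = step e j q , ¬Any⇒All¬ (vertices q) u∉q ∷ path , +-monoʳ-≤ _ q≤p
  ...   | yes u∈q with split q u∈q
  ...     | q₁ , q₂ , refl = q₂ , IsPath-suffix q₁ q₂ path ,
    ≤-trans (x≤y+x (weightOf-nonNegative q₁))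
      (≤-trans (≤-reflexive (≈-sym (weightOf-∙ q₁ q₂)))
        (≤-trans q≤p (x≤y+x (nonNegative e))))

  -- Loop erasure turns bounds over all walks into a distance over paths, so walks can be
  -- concatenated freely elsewhere.
  isDistance : ∀ {d} (p : Walk u v) → weightOf p ≤ d → (∀ (q : Walk u v) → d ≤ weightOf q) →
               IsDistance F G u v d
  isDistance p p≤d minimal =
    let q , path , q≤p = eraseLoops p
    in (q , path , antisym (≤-trans q≤p p≤d) (minimal q)) , λ r _ → minimal r

  lightestWalk : (p : Walk u v) → ∃[ q ] (∀ (r : Walk u v) → weightOf q ≤ weightOf r)
  lightestWalk {u = u} {v} p = q , minimal
    where
    open Data.List.Extrema totalOrder
    candidates : List (Walk u v)
    candidates = walks (ℓ ℕ.* ω) u v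
    q : Walk u v
    -- `p` is only the default value of `argmin`; minimality comes from the candidates, among which
    -- is every path.
    q = argmin weightOf p candidates
    minimal : ∀ r → weightOf q ≤ weightOf r
    minimal r =
      let r′ , path , r′≤r = eraseLoops r
          r′∈ = ∈-walks (ℓ ℕ.* ω) r′ (path-length r′ path)
      in ≤-trans (All.lookup (f[argmin]≤f[xs] {f = weightOf} p candidates) r′∈) r′≤r

-- Walks between interleaved terminals meet

<ᵇ-suc : ∀ m n → n ≢ suc m → (m <ᵇ n) ≡ (suc m <ᵇ n)
<ᵇ-suc m       zero          _   = refl
<ᵇ-suc zero    (suc zero)    n≢1 = contradiction refl n≢1
<ᵇ-suc zero    (suc (suc n)) _   = refl
<ᵇ-suc (suc m) (suc n)       n≢  = <ᵇ-suc m n (n≢ ∘ cong suc)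

<⇒<ᵇ≡true : ∀ {m n} → m ℕ.< n → (m <ᵇ n) ≡ true
<⇒<ᵇ≡true m<n = Equivalence.to T-≡ (ℕ.<⇒<ᵇ m<n)

≥⇒<ᵇ≡false : ∀ {m n} → n ℕ.≤ m → (m <ᵇ n) ≡ false
≥⇒<ᵇ≡false {m} {n} n≤m with m <ᵇ n in eq
... | false = refl
... | true  = contradiction (ℕ.<ᵇ⇒< m n (Equivalence.from T-≡ eq)) (ℕ.≤⇒≯ n≤m)

∧-cong-guarded : ∀ m n {a b} → (m ≡ n → a ≡ b) → (m ≡ᵇ n) ∧ a ≡ (m ≡ᵇ n) ∧ b
∧-cong-guarded m n a≡b with m ≡ᵇ n in eq
... | false = refl
... | true  = a≡b (ℕ.≡ᵇ⇒≡ m n (Equivalence.from T-≡ eq))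

leftOf : Vertex ω ℓ → Vertex ω ℓ → Bool
leftOf (r , c) (a , b) = (toℕ r ≡ᵇ toℕ a) ∧ (toℕ c <ᵇ toℕ b)

-- Ray casting: the ray from column b runs leftwards, crossing the vertical edges
-- whose upper row satisfies t.  The parity of the crossings with a walk tells the
-- two sides of the walk apart.
crossesRay : (ℕ → Bool) → ℕ → Edge ω ℓ → Bool
crossesRay t b (horizontal _ _) = false
crossesRay t b (vertical r c)   = t (toℕ r) ∧ (toℕ c <ᵇ b)

crossings : (ℕ → Bool) → ℕ → Walk u v → Bool
crossings t b stop         = false
crossings t b (step e _ p) = crossesRay t b e xor crossings t b p

-- The rays from x = (a , b) run just below and just above row a.
below above : {u v : Vertex ω ℓ} → Vertex ω ℓ → Walk u v → Bool
below (a , b) = crossings (_≡ᵇ toℕ a) (toℕ b)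
above (a , b) = crossings (λ r → suc r ≡ᵇ toℕ a) (toℕ b)

leftOf-horizontal : ∀ (r : Fin ℓ) (c : Fin ω) x → (r , suc c) ≢ x →
                    leftOf (r , inject₁ c) x ≡ leftOf (r , suc c) x
leftOf-horizontal r c (a , b) ≢x rewrite Fin.toℕ-inject₁ c =
  ∧-cong-guarded (toℕ r) (toℕ a) λ r≡a → <ᵇ-suc (toℕ c) (toℕ b) λ b≡ →
    ≢x (cong₂ _,_ (Fin.toℕ-injective r≡a) (Fin.toℕ-injective (sym b≡)))

xor-cancel : ∀ {a b} → a ≡ b → false ≡ a xor b
xor-cancel {a} refl = sym (xor-same a)

-- A vertical edge crosses one of the two rays exactly when it enters or leaves the row of `x` to
-- the left of `x`. A horizontal edge crosses neither, and cannot pass `x` without touching it.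
step-above-below : Joins e u v → ∀ x → u ≢ x → v ≢ x →
  crossesRay (λ r → suc r ≡ᵇ toℕ (proj₁ x)) (toℕ (proj₂ x)) e xor
  crossesRay (_≡ᵇ toℕ (proj₁ x)) (toℕ (proj₂ x)) e ≡ leftOf u x xor leftOf v x
step-above-below (rightward r c) x u≢x v≢x = xor-cancel (leftOf-horizontal r c x v≢x)
step-above-below (leftward r c)  x u≢x v≢x = xor-cancel (sym (leftOf-horizontal r c x u≢x))
step-above-below (downward r c) (a , b) _ _ rewrite Fin.toℕ-inject₁ r =
  xor-comm ((suc (toℕ r) ≡ᵇ toℕ a) ∧ (toℕ c <ᵇ toℕ b)) _
step-above-below (upward r c) (a , b) _ _ rewrite Fin.toℕ-inject₁ r = refl

xor-interchange : ∀ a b c d → (a xor b) xor (c xor d) ≡ (a xor c) xor (b xor d)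
xor-interchange = solve 4 (λ a b c d → (a :+ b) :+ (c :+ d) := (a :+ c) :+ (b :+ d)) refl
  where open xor-∧-Solver

xor-telescope : ∀ a b c → (a xor b) xor (b xor c) ≡ a xor c
xor-telescope a false c = cong (_xor c) (xor-identityʳ a)
xor-telescope false true false = refl
xor-telescope false true true = refl
xor-telescope true true false = refl
xor-telescope true true true = refl

-- The steps are summed modulo 2, and the `leftOf` terms of inner vertices cancel.
above-below : (p : Walk u v) → ∀ x → x ∉ vertices p →
              above x p xor below x p ≡ leftOf u x xor leftOf v x
above-below {u = u} stop x _ = sym (xor-same (leftOf u x))
above-below {u = u} {v} (step {v = w} e j p) x x∉ = begin
  (ae xor above x p) xor (be xor below x p)   ≡⟨ xor-interchange ae (above x p) be (below x p) ⟩
  (ae xor be) xor (above x p xor below x p)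
    ≡⟨ cong₂ _xor_ (step-above-below j x u≢x w≢x) (above-below p x (x∉ ∘ there)) ⟩
  (leftOf u x xor leftOf w x) xor (leftOf w x xor leftOf v x)
    ≡⟨ xor-telescope (leftOf u x) (leftOf w x) _ ⟩
  leftOf u x xor leftOf v x                   ∎
  where
  open ≡-Reasoning
  ae = crossesRay (λ r → suc r ≡ᵇ toℕ (proj₁ x)) (toℕ (proj₂ x)) e
  be = crossesRay (_≡ᵇ toℕ (proj₁ x)) (toℕ (proj₂ x)) e
  u≢x : u ≢ x
  u≢x refl = x∉ (here refl)
  w≢x : w ≢ x
  w≢x refl = x∉ (there (start∈ p))

crossings-none : ∀ b (p : Walk u v) → crossings (λ _ → false) b p ≡ false
crossings-none b stop                        = refl
crossings-none b (step (horizontal _ _) _ p) = crossings-none b p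
crossings-none b (step (vertical _ _) _ p)   = crossings-none b p

-- The two rays differ at most in the vertical edge with upper end `(r , inject₁ c)`, which a step
-- avoiding that vertex does not traverse.
step-below-horizontal : Joins e u v → ∀ (r : Fin ℓ) (c : Fin ω) →
  u ≢ (r , inject₁ c) → v ≢ (r , inject₁ c) →
  crossesRay (_≡ᵇ toℕ r) (toℕ (inject₁ c)) e ≡ crossesRay (_≡ᵇ toℕ r) (suc (toℕ c)) e
step-below-horizontal {e = horizontal _ _} _ _ _ _ _ = refl
step-below-horizontal {e = vertical r′ c′} j r c u≢ v≢ rewrite Fin.toℕ-inject₁ c =
  ∧-cong-guarded (toℕ r′) (toℕ r) λ r′≡r →
    sym (<ᵇ-suc (toℕ c′) (suc (toℕ c)) λ c≡c′ → untouched j r′≡r (ℕ.suc-injective c≡c′) u≢ v≢)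
  where
  coincide : toℕ r′ ≡ toℕ r → toℕ c ≡ toℕ c′ → (inject₁ r′ , c′) ≡ (r , inject₁ c)
  coincide r≡ c≡ = cong₂ _,_ (Fin.toℕ-injective (trans (Fin.toℕ-inject₁ r′) r≡))
                             (Fin.toℕ-injective (sym (trans (Fin.toℕ-inject₁ c) c≡)))
  untouched : ∀ {u v} → Joins (vertical r′ c′) u v → toℕ r′ ≡ toℕ r → toℕ c ≡ toℕ c′ →
              u ≢ (r , inject₁ c) → v ≢ (r , inject₁ c) → ⊥
  untouched (downward _ _) r≡ c≡ u≢ v≢ = u≢ (coincide r≡ c≡)
  untouched (upward _ _)   r≡ c≡ u≢ v≢ = v≢ (coincide r≡ c≡)

below-horizontal : (p : Walk u v) (r : Fin ℓ) (c : Fin ω) → (r , inject₁ c) ∉ vertices p →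
                   below (r , inject₁ c) p ≡ below (r , suc c) p
below-horizontal stop         r c _  = refl
below-horizontal (step e j p) r c ∉p = cong₂ _xor_
  (step-below-horizontal j r c (λ { refl → ∉p (here refl) }) (λ { refl → ∉p (there (start∈ p)) }))
  (below-horizontal p r c (∉p ∘ there))

module _ {ω h : ℕ} {i k : Fin ω} (p : Walk {ℓ = suc h} (firstRow i) (firstRow k)) where

  -- The ends of `p` lie in row 0, hence outside the row of `(suc r , c)`, so both rays from that
  -- vertex have the same parity. Its upper ray is the lower ray from `(inject₁ r , c)`.
  below-vertical : (r : Fin h) (c : Fin ω) → (suc r , c) ∉ vertices p →
                   below (inject₁ r , c) p ≡ below (suc r , c) p
  below-vertical r c ∉p rewrite Fin.toℕ-inject₁ r = xor-false⇒≡ _ _ (above-below p (suc r , c) ∉p)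
    where
    xor-false⇒≡ : ∀ a b → a xor b ≡ false → a ≡ b
    xor-false⇒≡ false false _ = refl
    xor-false⇒≡ true  true  _ = refl

  -- No edge runs above the first row, so the upper ray has parity `false` and only the ends of `p`
  -- count.
  below-firstRow : (b : Fin ω) → (zero , b) ∉ vertices p →
                   below (zero , b) p ≡ (toℕ i <ᵇ toℕ b) xor (toℕ k <ᵇ toℕ b)
  below-firstRow b ∉p =
    trans (cong (_xor below (zero , b) p) (sym (crossings-none (toℕ b) p)))
          (above-below p (zero , b) ∉p)

  below-step : Joins e x y → x ∉ vertices p → y ∉ vertices p → below x p ≡ below y p
  below-step (rightward r c) x∉ y∉ = below-horizontal p r c x∉
  below-step (leftward r c)  x∉ y∉ = sym (below-horizontal p r c y∉)
  below-step (downward r c)  x∉ y∉ = below-vertical r c y∉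
  below-step (upward r c)    x∉ y∉ = sym (below-vertical r c x∉)

  below-walk : (q : Walk x y) → (∀ {z} → z ∈ vertices q → z ∉ vertices p) → below x p ≡ below y p
  below-walk stop         _        = refl
  below-walk (step _ j q) disjoint =
    trans (below-step j (disjoint (here refl)) (disjoint (there (start∈ q))))
          (below-walk q (disjoint ∘ there))

-- If the walks were disjoint, the parity `below` of `p` would be constant along `q`. But exactly
-- one end of `p` lies to the left of `j`, and both lie to the left of `l`.
walks-cross : ∀ {h} {i j k l : Fin ω} → i Fin.≤ j → j Fin.≤ k → k Fin.≤ l →
              (p : Walk {ℓ = suc h} (firstRow i) (firstRow k)) (q : Walk (firstRow j) (firstRow l)) →
              ∃[ x ] x ∈ vertices p × x ∈ vertices q
walks-cross {i = i} {j} {k} {l} i≤j j≤k k≤l p q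
  with Any.any? (λ x → Any.any? (x ≟ᵥ_) (vertices q)) (vertices p)
... | yes common = find common
... | no disjoint = contradiction true≡false λ ()
  where
  q∉p : ∀ {x} → x ∈ vertices q → x ∉ vertices p
  q∉p x∈q x∈p = disjoint (Any.map (λ { refl → x∈q }) x∈p)
  -- Disjointness makes `i ≤ j` and `k ≤ l` strict, as the comparisons `<ᵇ` require.
  distinct : ∀ {a b} → a Fin.≤ b → firstRow a ∈ vertices p → firstRow b ∈ vertices q → a Fin.< b
  distinct a≤b a∈p b∈q = ℕ.≤∧≢⇒< a≤b λ a≡b →
    q∉p b∈q (subst (λ c → firstRow c ∈ vertices p) (Fin.toℕ-injective a≡b) a∈p)
  true≡false : true ≡ false
  true≡false = begin
    true
      ≡⟨ cong₂ _xor_ (<⇒<ᵇ≡true (distinct i≤j (start∈ p) (start∈ q))) (≥⇒<ᵇ≡false j≤k) ⟨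
    (toℕ i <ᵇ toℕ j) xor (toℕ k <ᵇ toℕ j)  ≡⟨ below-firstRow p j (q∉p (start∈ q)) ⟨
    below (zero , j) p                     ≡⟨ below-walk p q q∉p ⟩
    below (zero , l) p                     ≡⟨ below-firstRow p l (q∉p (end∈ q)) ⟩
    (toℕ i <ᵇ toℕ l) xor (toℕ k <ᵇ toℕ l)
      ≡⟨ cong₂ _xor_ (<⇒<ᵇ≡true (ℕ.≤-<-trans (ℕ.≤-trans i≤j j≤k) k<l)) (<⇒<ᵇ≡true k<l) ⟩
    false                                  ∎
    where
    open ≡-Reasoning
    k<l = distinct k≤l (end∈ p) (end∈ q)

-- Realising a metric by a grid

-- When `m` grows by one, `m ⊔ n` grows by at most one and cannot jump over `s`. This provides the
-- case distinction of `VerticalMove-close`.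
≤⊎suc⊔≤ : ∀ s m n → s ℕ.≤ m ⊔ n ⊎ suc m ⊔ n ℕ.≤ s
≤⊎suc⊔≤ s m n with ℕ.≤-<-connex s (m ⊔ n)
... | inj₁ s≤ = inj₁ s≤
... | inj₂ s> = inj₂ (ℕ.⊔-lub (ℕ.≤-<-trans (ℕ.m≤m⊔n m n) s>) (ℕ.m⊔n≤o⇒n≤o m n (ℕ.<⇒≤ s>)))

≤⊎⊔suc≤ : ∀ s m n → s ℕ.≤ m ⊔ n ⊎ m ⊔ suc n ℕ.≤ s
≤⊎⊔suc≤ s m n with ℕ.≤-<-connex s (m ⊔ n)
... | inj₁ s≤ = inj₁ s≤
... | inj₂ s> = inj₂ (ℕ.⊔-lub (ℕ.m⊔n≤o⇒m≤o m n (ℕ.<⇒≤ s>)) (ℕ.≤-<-trans (ℕ.m≤n⊔m m n) s>))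

module _ {c ℓ₁ ℓ₂} (F : OrderedField c ℓ₁ ℓ₂) where
  open Arithmetic F

  -- A pair (p , q) stands for p - q: without subtraction, the commutative monoid
  -- solver applies.
  Close : Carrier → Carrier × Carrier → Carrier × Carrier → Set ℓ₂
  Close w (p , q) (p′ , q′) = p + q′ ≤ w + w + (p′ + q) × p′ + q ≤ w + w + (p + q′)

  Close-resp-≡ : ∀ {w f f′ g g′} → f ≡ f′ → g ≡ g′ → Close w f′ g′ → Close w f g
  Close-resp-≡ refl refl close = close

  Close-sym : ∀ {w f g} → Close w f g → Close w g f
  Close-sym = swap

  Close-trans : ∀ {w w′ f g h} → Close w f g → Close w′ g h → Close (w + w′) f h
  Close-trans (a , b) (a′ , b′) =
    chain a a′ , ≤-respʳ-≈ (+-congʳ (+-cong (+-comm _ _) (+-comm _ _))) (chain b′ b)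
    where
    chain : ∀ {w w′ p q p′ q′ p″ q″} →
            p + q′ ≤ w + w + (p′ + q) → p′ + q″ ≤ w′ + w′ + (p″ + q′) →
            p + q″ ≤ (w + w′) + (w + w′) + (p″ + q)
    chain {w} {w′} {p} {q} {p′} {q′} {p″} {q″} x y = ≤-from (+-mono-≤ x y)
      (solve 8 (λ w w′ p q p′ q′ p″ q″ →
        (p ⊕ q″) ⊕ ((w ⊕ w ⊕ (p′ ⊕ q)) ⊕ (w′ ⊕ w′ ⊕ (p″ ⊕ q′))) ⊜
        (((w ⊕ w′) ⊕ (w ⊕ w′) ⊕ (p″ ⊕ q)) ⊕ ((p ⊕ q′) ⊕ (p′ ⊕ q″)))) ≈-refl w w′ p q p′ q′ p″ q″)

  Close-exact : ∀ {w p q p′ q′} → 0# ≤ w → p + q′ ≈ w + w + (p′ + q) → Close w (p , q) (p′ , q′)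
  Close-exact 0≤w eq = ≤-reflexive eq ,
    ≤-trans (x≤y+x 0≤2w) (≤-trans (≤-reflexive (≈-sym eq)) (x≤y+x 0≤2w))
    where 0≤2w = +-nonNegative 0≤w 0≤w

  -- `cross₁` and `cross₂` are the Kalmanson conditions: crossing pairs outweigh disjoint and nested
  -- ones. With `j = k`, `cross₂` and `diagonal` yield the triangle inequality.
  module Emulator
    (d : ℕ → ℕ → Carrier)
    (diagonal : ∀ i → d i i ≈ 0#)
    (cross₁ : ∀ {i j k l} → i ℕ.≤ j → j ℕ.≤ k → k ℕ.≤ l → d i j + d k l ≤ d i k + d j l)
    (cross₂ : ∀ {i j k l} → i ℕ.≤ j → j ℕ.≤ k → k ℕ.≤ l → d i l + d j k ≤ d i k + d j l)
    (m : ℕ)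
    where
    -- The weight formula for a change of `a`, with the negative terms moved across;
    -- `HorizontalMove` is the one for `b`. A horizontal edge of the grid can involve both.
    VerticalMove : ℕ → ℕ → ℕ → Carrier → Set ℓ₁
    VerticalMove b a a′ w = w + w + (d b a + d a′ m) ≈ d b a′ + d a m

    HorizontalMove : ℕ → ℕ → ℕ → Carrier → Set ℓ₁
    HorizontalMove a b b′ w = w + w + (d b m + d b′ a) ≈ d b a + d b′ m

    -- Twice the distance between the labels (s , s) and (a , b), where b ≤ a; the
    -- number (s ⊓ a) ⊔ b is s clamped to the interval [b , a].
    potential : ℕ → ℕ → ℕ → Carrier × Carrier
    potential s a b = t + t , d b a + d a m + d b m
      where t = d (s ⊓ b) (s ⊔ a) + d ((s ⊓ a) ⊔ b) m

    -- Here and in the next two lemmas `s` lies above, within or below `[b , a]`, so that the minima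
    -- and maxima evaluate.
    potential₁ : ∀ {s a b} → b ℕ.≤ a → a ℕ.≤ s → potential s a b ≡
      ((d b s + d a m) + (d b s + d a m) , d b a + d a m + d b m)
    potential₁ b≤a a≤s rewrite ℕ.m≥n⇒m⊓n≡n (ℕ.≤-trans b≤a a≤s) | ℕ.m≥n⇒m⊔n≡m a≤s
      | ℕ.m≥n⇒m⊓n≡n a≤s | ℕ.m≥n⇒m⊔n≡m b≤a = refl

    potential₂ : ∀ {s a b} → b ℕ.≤ s → s ℕ.≤ a → potential s a b ≡
      ((d b a + d s m) + (d b a + d s m) , d b a + d a m + d b m)
    potential₂ b≤s s≤a rewrite ℕ.m≥n⇒m⊓n≡n b≤s | ℕ.m≤n⇒m⊔n≡n s≤a
      | ℕ.m≤n⇒m⊓n≡m s≤a | ℕ.m≥n⇒m⊔n≡m b≤s = refl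

    potential₃ : ∀ {s a b} → b ℕ.≤ a → s ℕ.≤ b → potential s a b ≡
      ((d s a + d b m) + (d s a + d b m) , d b a + d a m + d b m)
    potential₃ b≤a s≤b rewrite ℕ.m≤n⇒m⊓n≡m s≤b | ℕ.m≤n⇒m⊔n≡n (ℕ.≤-trans s≤b b≤a)
      | ℕ.m≤n⇒m⊓n≡m (ℕ.≤-trans s≤b b≤a) | ℕ.m≤n⇒m⊔n≡n s≤b = refl

    double : ∀ {x y} → x ≤ y → x + x ≤ y + y
    double x≤y = +-mono-≤ x≤y x≤y

    -- For `a′ ≤ s` the potential falls by exactly `w + w`, and for `b ≤ s ≤ a` it rises by as much.
    -- For `s ≤ b` the two bounds come from `cross₁` at `s , a , a′ , m` and `cross₂` at
    -- `s , b , a , a′`.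
    VerticalMove-close : ∀ {s b a a′ w} → b ℕ.≤ a → a ℕ.≤ a′ → a′ ℕ.≤ m → s ℕ.≤ a ⊎ a′ ℕ.≤ s →
      0# ≤ w → VerticalMove b a a′ w → Close w (potential s a b) (potential s a′ b)
    VerticalMove-close {s} {b} {a} {a′} {w} b≤a a≤a′ a′≤m (inj₂ a′≤s) 0≤w e =
      Close-resp-≡ (potential₁ b≤a (ℕ.≤-trans a≤a′ a′≤s)) (potential₁ (ℕ.≤-trans b≤a a≤a′) a′≤s) $
      Close-exact 0≤w (≈-from (≈-sym e) (solve 7 (λ w bs am ba′ a′m bm ba →
        (((bs ⊕ am) ⊕ (bs ⊕ am)) ⊕ (ba′ ⊕ a′m ⊕ bm)) ⊕ (w ⊕ w ⊕ (ba ⊕ a′m)) ⊜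
        (w ⊕ w ⊕ (((bs ⊕ a′m) ⊕ (bs ⊕ a′m)) ⊕ (ba ⊕ am ⊕ bm))) ⊕ (ba′ ⊕ am))
        ≈-refl w (d b s) (d a m) (d b a′) (d a′ m) (d b m) (d b a)))
    VerticalMove-close {s} {b} {a} {a′} {w} b≤a a≤a′ a′≤m (inj₁ s≤a) 0≤w e with ℕ.≤-total b s
    ... | inj₁ b≤s = Close-resp-≡ (potential₂ b≤s s≤a) (potential₂ b≤s (ℕ.≤-trans s≤a a≤a′)) $
      Close-sym (Close-exact 0≤w (≈-from (≈-sym e) (solve 7 (λ w sm am ba′ a′m bm ba →
        (((ba′ ⊕ sm) ⊕ (ba′ ⊕ sm)) ⊕ (ba ⊕ am ⊕ bm)) ⊕ (w ⊕ w ⊕ (ba ⊕ a′m)) ⊜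
        (w ⊕ w ⊕ (((ba ⊕ sm) ⊕ (ba ⊕ sm)) ⊕ (ba′ ⊕ a′m ⊕ bm))) ⊕ (ba′ ⊕ am))
        ≈-refl w (d s m) (d a m) (d b a′) (d a′ m) (d b m) (d b a))))
    ... | inj₂ s≤b = Close-resp-≡ (potential₃ b≤a s≤b) (potential₃ (ℕ.≤-trans b≤a a≤a′) s≤b) $
      (≤-from (+-mono-≤ (double (cross₁ (ℕ.≤-trans s≤b b≤a) a≤a′ a′≤m)) (≤-reflexive (≈-sym e)))
        (solve 8 (λ w sa sa′ am ba′ a′m bm ba →
          ((sa ⊕ bm) ⊕ (sa ⊕ bm)) ⊕ (ba′ ⊕ a′m ⊕ bm)
            ⊕ ((sa′ ⊕ am) ⊕ (sa′ ⊕ am) ⊕ (w ⊕ w ⊕ (ba ⊕ a′m))) ⊜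
          (w ⊕ w ⊕ (((sa′ ⊕ bm) ⊕ (sa′ ⊕ bm)) ⊕ (ba ⊕ am ⊕ bm)))
            ⊕ ((sa ⊕ a′m) ⊕ (sa ⊕ a′m) ⊕ (ba′ ⊕ am)))
          ≈-refl w (d s a) (d s a′) (d a m) (d b a′) (d a′ m) (d b m) (d b a)) ,
      ≤-from (+-mono-≤ (double (cross₂ s≤b b≤a a≤a′)) (≤-reflexive (≈-sym e)))
        (solve 8 (λ w sa sa′ am ba′ a′m bm ba →
          ((sa′ ⊕ bm) ⊕ (sa′ ⊕ bm)) ⊕ (ba ⊕ am ⊕ bm)
            ⊕ ((sa ⊕ ba′) ⊕ (sa ⊕ ba′) ⊕ (w ⊕ w ⊕ (ba ⊕ a′m))) ⊜
          (w ⊕ w ⊕ (((sa ⊕ bm) ⊕ (sa ⊕ bm)) ⊕ (ba′ ⊕ a′m ⊕ bm)))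
            ⊕ ((sa′ ⊕ ba) ⊕ (sa′ ⊕ ba) ⊕ (ba′ ⊕ am)))
          ≈-refl w (d s a) (d s a′) (d a m) (d b a′) (d a′ m) (d b m) (d b a)))

    -- The change is exactly `w + w` for `s ≤ b` and for `b′ ≤ s ≤ a`. For `a ≤ s` the two bounds
    -- come from `cross₂` at `b , b′ , a , s` and at `b , b′ , s , m`.
    HorizontalMove-close : ∀ {s a b b′ w} → b ℕ.≤ b′ → b′ ℕ.≤ a → a ℕ.≤ m → s ℕ.≤ m →
      s ℕ.≤ b ⊎ b′ ℕ.≤ s → 0# ≤ w → HorizontalMove a b b′ w → Close w (potential s a b) (potential s a b′)
    HorizontalMove-close {s} {a} {b} {b′} {w} b≤b′ b′≤a a≤m s≤m (inj₁ s≤b) 0≤w e =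
      Close-resp-≡ (potential₃ (ℕ.≤-trans b≤b′ b′≤a) s≤b) (potential₃ b′≤a (ℕ.≤-trans s≤b b≤b′)) $
      Close-sym (Close-exact 0≤w (≈-from (≈-sym e) (solve 7 (λ w sa am ba b′a bm b′m →
        (((sa ⊕ b′m) ⊕ (sa ⊕ b′m)) ⊕ (ba ⊕ am ⊕ bm)) ⊕ (w ⊕ w ⊕ (bm ⊕ b′a)) ⊜
        (w ⊕ w ⊕ (((sa ⊕ bm) ⊕ (sa ⊕ bm)) ⊕ (b′a ⊕ am ⊕ b′m))) ⊕ (ba ⊕ b′m))
        ≈-refl w (d s a) (d a m) (d b a) (d b′ a) (d b m) (d b′ m))))
    HorizontalMove-close {s} {a} {b} {b′} {w} b≤b′ b′≤a a≤m s≤m (inj₂ b′≤s) 0≤w e with ℕ.≤-total s a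
    ... | inj₁ s≤a = Close-resp-≡ (potential₂ (ℕ.≤-trans b≤b′ b′≤s) s≤a) (potential₂ b′≤s s≤a) $
      Close-exact 0≤w (≈-from (≈-sym e) (solve 7 (λ w sm am ba b′a bm b′m →
        (((ba ⊕ sm) ⊕ (ba ⊕ sm)) ⊕ (b′a ⊕ am ⊕ b′m)) ⊕ (w ⊕ w ⊕ (bm ⊕ b′a)) ⊜
        (w ⊕ w ⊕ (((b′a ⊕ sm) ⊕ (b′a ⊕ sm)) ⊕ (ba ⊕ am ⊕ bm))) ⊕ (ba ⊕ b′m))
        ≈-refl w (d s m) (d a m) (d b a) (d b′ a) (d b m) (d b′ m)))
    ... | inj₂ a≤s = Close-resp-≡ (potential₁ (ℕ.≤-trans b≤b′ b′≤a) a≤s) (potential₁ b′≤a a≤s) $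
      (≤-from (+-mono-≤ (double (cross₂ b≤b′ b′≤a a≤s)) (≤-reflexive (≈-sym e)))
        (solve 8 (λ w bs b′s am ba b′a bm b′m →
          ((bs ⊕ am) ⊕ (bs ⊕ am)) ⊕ (b′a ⊕ am ⊕ b′m)
            ⊕ ((ba ⊕ b′s) ⊕ (ba ⊕ b′s) ⊕ (w ⊕ w ⊕ (bm ⊕ b′a))) ⊜
          (w ⊕ w ⊕ (((b′s ⊕ am) ⊕ (b′s ⊕ am)) ⊕ (ba ⊕ am ⊕ bm)))
            ⊕ ((bs ⊕ b′a) ⊕ (bs ⊕ b′a) ⊕ (ba ⊕ b′m)))
          ≈-refl w (d b s) (d b′ s) (d a m) (d b a) (d b′ a) (d b m) (d b′ m)) ,
      ≤-from (+-mono-≤ (double (cross₂ b≤b′ b′≤s s≤m)) (≤-reflexive (≈-sym e)))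
        (solve 8 (λ w bs b′s am ba b′a bm b′m →
          ((b′s ⊕ am) ⊕ (b′s ⊕ am)) ⊕ (ba ⊕ am ⊕ bm)
            ⊕ ((bs ⊕ b′m) ⊕ (bs ⊕ b′m) ⊕ (w ⊕ w ⊕ (bm ⊕ b′a))) ⊜
          (w ⊕ w ⊕ (((bs ⊕ am) ⊕ (bs ⊕ am)) ⊕ (b′a ⊕ am ⊕ b′m)))
            ⊕ ((bm ⊕ b′s) ⊕ (bm ⊕ b′s) ⊕ (ba ⊕ b′m)))
          ≈-refl w (d b s) (d b′ s) (d a m) (d b a) (d b′ a) (d b m) (d b′ m)))

    verticalMove : ∀ {b a a′} → b ℕ.≤ a → a ℕ.≤ a′ → a′ ℕ.≤ m →
                   ∃[ w ] 0# ≤ w × VerticalMove b a a′ w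
    verticalMove b≤a a≤a′ a′≤m = half-difference (cross₁ b≤a a≤a′ a′≤m)

    horizontalMove : ∀ {a b b′} → b ℕ.≤ b′ → b′ ℕ.≤ a → a ℕ.≤ m →
                     ∃[ w ] 0# ≤ w × HorizontalMove a b b′ w
    horizontalMove b≤b′ b′≤a a≤m = half-difference (cross₂ b≤b′ b′≤a a≤m)

    toℕ≤m : (i : Fin (suc m)) → toℕ i ℕ.≤ m
    toℕ≤m i = ℕ.≤-pred (Fin.toℕ<n i)

    downMove : (r : Fin m) (c : Fin (suc m)) →
               ∃[ w ] 0# ≤ w × VerticalMove (toℕ c) (toℕ r ⊔ toℕ c) (suc (toℕ r) ⊔ toℕ c) w
    downMove r c = verticalMove (ℕ.m≤n⊔m (toℕ r) (toℕ c)) (ℕ.⊔-monoˡ-≤ (toℕ c) (ℕ.n≤1+n (toℕ r)))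
      (ℕ.⊔-lub (Fin.toℕ<n r) (toℕ≤m c))

    rightMove₁ : (r : Fin (suc m)) (c : Fin m) →
                 ∃[ w ] 0# ≤ w × VerticalMove (toℕ c) (toℕ r ⊔ toℕ c) (toℕ r ⊔ suc (toℕ c)) w
    rightMove₁ r c = verticalMove (ℕ.m≤n⊔m (toℕ r) (toℕ c)) (ℕ.⊔-monoʳ-≤ (toℕ r) (ℕ.n≤1+n (toℕ c)))
      (ℕ.⊔-lub (toℕ≤m r) (Fin.toℕ<n c))

    rightMove₂ : (r : Fin (suc m)) (c : Fin m) →
                 ∃[ w ] 0# ≤ w × HorizontalMove (toℕ r ⊔ suc (toℕ c)) (toℕ c) (suc (toℕ c)) w
    rightMove₂ r c = horizontalMove (ℕ.n≤1+n (toℕ c)) (ℕ.m≤n⊔m (toℕ r) (suc (toℕ c)))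
      (ℕ.⊔-lub (toℕ≤m r) (Fin.toℕ<n c))

    grid : WeightedGrid F (suc m) (suc m)
    grid = record
      { weight = λ
        { (horizontal r c) → proj₁ (rightMove₁ r c) + proj₁ (rightMove₂ r c)
        ; (vertical r c)   → proj₁ (downMove r c)
        }
      ; nonNegative = λ
        { (horizontal r c) →
            +-nonNegative (proj₁ (proj₂ (rightMove₁ r c))) (proj₁ (proj₂ (rightMove₂ r c)))
        ; (vertical r c)   → proj₁ (proj₂ (downMove r c))
        }
      }

    open WeightedGrid grid
    open Distance F grid

    φ : ℕ → Vertex (suc m) (suc m) → Carrier × Carrier
    φ s (r , c) = potential s (toℕ r ⊔ toℕ c) (toℕ c)

    φ-down : ∀ s (r : Fin m) c → Close (weight (vertical r c)) (φ s (inject₁ r , c)) (φ s (suc r , c))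
    φ-down s r c rewrite Fin.toℕ-inject₁ r =
      let w , 0≤w , move = downMove r c in
      VerticalMove-close (ℕ.m≤n⊔m (toℕ r) (toℕ c)) (ℕ.⊔-monoˡ-≤ (toℕ c) (ℕ.n≤1+n (toℕ r)))
        (ℕ.⊔-lub (Fin.toℕ<n r) (toℕ≤m c)) (≤⊎suc⊔≤ s (toℕ r) (toℕ c)) 0≤w move

    φ-right : ∀ {s} → s ℕ.≤ m → ∀ r (c : Fin m) →
              Close (weight (horizontal r c)) (φ s (r , inject₁ c)) (φ s (r , suc c))
    φ-right {s} s≤m r c rewrite Fin.toℕ-inject₁ c =
      let _ , 0≤w₁ , move₁ = rightMove₁ r c
          _ , 0≤w₂ , move₂ = rightMove₂ r c
      in Close-trans
        -- The label between the two moves: `a` has been raised, `b` not yet.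
        {g = potential s (toℕ r ⊔ suc (toℕ c)) (toℕ c)}
        (VerticalMove-close (ℕ.m≤n⊔m (toℕ r) (toℕ c)) (ℕ.⊔-monoʳ-≤ (toℕ r) (ℕ.n≤1+n (toℕ c)))
          (ℕ.⊔-lub (toℕ≤m r) (Fin.toℕ<n c)) (≤⊎⊔suc≤ s (toℕ r) (toℕ c)) 0≤w₁ move₁)
        (HorizontalMove-close (ℕ.n≤1+n (toℕ c)) (ℕ.m≤n⊔m (toℕ r) (suc (toℕ c)))
          (ℕ.⊔-lub (toℕ≤m r) (Fin.toℕ<n c)) s≤m (ℕ.≤-<-connex s (toℕ c)) 0≤w₂ move₂)

    φ-edge : ∀ {s} → s ℕ.≤ m → ∀ {e u v} → Joins e u v → Close (weight e) (φ s u) (φ s v)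
    φ-edge s≤m (rightward r c) = φ-right s≤m r c
    φ-edge s≤m (leftward r c)  = Close-sym (φ-right s≤m r c)
    φ-edge s≤m (downward r c)  = φ-down _ r c
    φ-edge s≤m (upward r c)    = Close-sym (φ-down _ r c)

    φ-walk : ∀ {s} → s ℕ.≤ m → ∀ {u v} (p : Walk u v) → Close (weightOf p) (φ s u) (φ s v)
    φ-walk s≤m stop = Close-exact ≤-refl (≈-sym (0+0+x≈x _))
    φ-walk {s} s≤m (step {v = v} e j p) = Close-trans {g = φ s v} (φ-edge s≤m j) (φ-walk s≤m p)

    -- For `s = i` the potential is `d(i,i)` at the start and `2 d(i,j) - d(j,j)` at the end. The
    -- diagonal vanishes, so `2 d(i,j)` is at most twice the weight.
    walk-bound : ∀ {i j : Fin (suc m)} → i Fin.≤ j → (p : Walk (firstRow i) (firstRow j)) →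
                 d (toℕ i) (toℕ j) ≤ weightOf p
    walk-bound {i} {j} i≤j p = double-cancel-≤ (≤-from
      (+-mono-≤ (proj₂ close) (≤-reflexive (+-cong (diagonal i′) (diagonal j′))))
      (solve 6 (λ w ii ij im jj jm →
        (ij ⊕ ij) ⊕ ((w ⊕ w ⊕ (((ii ⊕ im) ⊕ (ii ⊕ im)) ⊕ (jj ⊕ jm ⊕ jm))) ⊕ (id ⊕ id)) ⊜
        (w ⊕ w) ⊕ ((((ij ⊕ jm) ⊕ (ij ⊕ jm)) ⊕ (ii ⊕ im ⊕ im)) ⊕ (ii ⊕ jj)))
        ≈-refl (weightOf p) (d i′ i′) (d i′ j′) (d i′ m) (d j′ j′) (d j′ m)))
      where
      i′ = toℕ i
      j′ = toℕ j
      close : Close (weightOf p)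
        ((d i′ i′ + d i′ m) + (d i′ i′ + d i′ m) , d i′ i′ + d i′ m + d i′ m)
        ((d i′ j′ + d j′ m) + (d i′ j′ + d j′ m) , d j′ j′ + d j′ m + d j′ m)
      close = subst₂ (Close (weightOf p))
        (potential₂ ℕ.≤-refl ℕ.≤-refl) (potential₃ ℕ.≤-refl i≤j) (φ-walk (toℕ≤m i) p)

    -- Walks that attain the distances

    VerticalMove-trans : ∀ {b a a′ a″ w w′ t} → VerticalMove b a a′ w → VerticalMove b a′ a″ w′ →
                         t ≈ w + w′ → VerticalMove b a a″ t
    VerticalMove-trans {b} {a} {a′} {a″} {w} {w′} e e′ t≈ = ≈-trans (+-congʳ (+-cong t≈ t≈))
      (≈-from (+-cong e e′) (solve 8 (λ w w′ ba am ba′ a′m ba″ a″m →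
        (w ⊕ w′) ⊕ (w ⊕ w′) ⊕ (ba ⊕ a″m) ⊕ ((ba′ ⊕ am) ⊕ (ba″ ⊕ a′m)) ⊜
        ba″ ⊕ am ⊕ ((w ⊕ w ⊕ (ba ⊕ a′m)) ⊕ (w′ ⊕ w′ ⊕ (ba′ ⊕ a″m))))
        ≈-refl w w′ (d b a) (d a m) (d b a′) (d a′ m) (d b a″) (d a″ m)))

    HorizontalMove-trans : ∀ {a b b′ b″ w w′ t} →
                           HorizontalMove a b b′ w → HorizontalMove a b′ b″ w′ →
                           t ≈ w + w′ → HorizontalMove a b b″ t
    HorizontalMove-trans {a} {b} {b′} {b″} {w} {w′} e e′ t≈ = ≈-trans (+-congʳ (+-cong t≈ t≈))
      (≈-from (+-cong e e′) (solve 8 (λ w w′ ba bm b′a b′m b″a b″m →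
        (w ⊕ w′) ⊕ (w ⊕ w′) ⊕ (bm ⊕ b″a) ⊕ ((ba ⊕ b′m) ⊕ (b′a ⊕ b″m)) ⊜
        ba ⊕ b″m ⊕ ((w ⊕ w ⊕ (bm ⊕ b′a)) ⊕ (w′ ⊕ w′ ⊕ (b′m ⊕ b″a))))
        ≈-refl w w′ (d b a) (d b m) (d b′ a) (d b′ m) (d b″ a) (d b″ m)))

    snoc-weight : ∀ {u v x e} (p : Walk u v) (j : Joins e v x) →
                  weightOf (p ∙ step e j stop) ≈ weightOf p + weight e
    snoc-weight p j = ≈-trans (weightOf-∙ p (step _ j stop)) (+-congˡ (+-identityʳ _))

    -- Moves telescope, so the weight of the whole walk is that of a single move. Down to row `i`
    -- the label stays `(i , i)` and the walk costs nothing.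
    DownWalk : Fin (suc m) → Fin (suc m) → Set ℓ₁
    DownWalk i r = Σ[ p ∈ Walk (firstRow i) (r , i) ]
      VerticalMove (toℕ i) (toℕ i) (toℕ r ⊔ toℕ i) (weightOf p)

    downWalk : ∀ i r → DownWalk i r
    downWalk i = <-weakInduction (DownWalk i) (stop , 0+0+x≈x _) extend
      where
      extend : ∀ r → DownWalk i (inject₁ r) → DownWalk i (suc r)
      extend r (p , move) = p ∙ step (vertical r i) (downward r i) stop ,
        VerticalMove-trans
          (subst (λ a → VerticalMove _ _ (a ⊔ toℕ i) (weightOf p)) (Fin.toℕ-inject₁ r) move)
          (proj₂ (proj₂ (downMove r i))) (snoc-weight p (downward r i))

    RightWalk : Fin (suc m) → Fin (suc m) → Fin (suc m) → Set ℓ₁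
    RightWalk r i j = Σ[ p ∈ Walk (r , i) (r , j) ]
      HorizontalMove (toℕ r) (toℕ i) (toℕ j) (weightOf p)

    -- Both ends have `a = r` here, so the `VerticalMove` share of the weight vanishes.
    edge-move : ∀ r (c : Fin m) → suc (toℕ c) ℕ.≤ toℕ r →
                HorizontalMove (toℕ r) (toℕ c) (suc (toℕ c)) (weight (horizontal r c))
    edge-move r c c<r = ≈-from (+-cong move₁′ move₂′) (solve 7 (λ w₁ w₂ ca am bm b′a b′m →
        (w₁ ⊕ w₂) ⊕ (w₁ ⊕ w₂) ⊕ (bm ⊕ b′a) ⊕ ((ca ⊕ am) ⊕ (ca ⊕ b′m)) ⊜
        ca ⊕ b′m ⊕ ((w₁ ⊕ w₁ ⊕ (ca ⊕ am)) ⊕ (w₂ ⊕ w₂ ⊕ (bm ⊕ b′a))))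
        ≈-refl (proj₁ (rightMove₁ r c)) (proj₁ (rightMove₂ r c))
        (d c′ a) (d a m) (d c′ m) (d (suc c′) a) (d (suc c′) m))
      where
      a = toℕ r
      c′ = toℕ c
      move₁′ : VerticalMove c′ a a (proj₁ (rightMove₁ r c))
      move₁′ = subst₂ (λ x y → VerticalMove c′ x y (proj₁ (rightMove₁ r c)))
        (ℕ.m≥n⇒m⊔n≡m (ℕ.<⇒≤ c<r)) (ℕ.m≥n⇒m⊔n≡m c<r) (proj₂ (proj₂ (rightMove₁ r c)))
      move₂′ : HorizontalMove a c′ (suc c′) (proj₁ (rightMove₂ r c))
      move₂′ = subst (λ x → HorizontalMove x c′ (suc c′) (proj₁ (rightMove₂ r c)))
        (ℕ.m≥n⇒m⊔n≡m c<r) (proj₂ (proj₂ (rightMove₂ r c)))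

    rightWalk : ∀ r {i j} → i Fin.≤ j → j Fin.≤ r → RightWalk r i j
    rightWalk r {i} i≤j j≤r = <-weakInduction-startingFrom (λ j → j Fin.≤ r → RightWalk r i j)
      (λ _ → stop , ≈-trans (0+0+x≈x _) (+-comm _ _)) extend i≤j j≤r
      where
      extend : ∀ c → (inject₁ c Fin.≤ r → RightWalk r i (inject₁ c)) →
               suc c Fin.≤ r → RightWalk r i (suc c)
      extend c walk c<r =
        let p , move = walk (subst (ℕ._≤ toℕ r) (sym (Fin.toℕ-inject₁ c)) (ℕ.<⇒≤ c<r)) in
        p ∙ step (horizontal r c) (rightward r c) stop ,
        HorizontalMove-trans
          (subst (λ b → HorizontalMove _ _ b (weightOf p)) (Fin.toℕ-inject₁ c) move)
          (edge-move r c c<r) (snoc-weight p (rightward r c))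

    -- Since the diagonal is zero, twice the weight is `d(i,j) + d(i,m) - d(j,m)` for the way down,
    -- `d(i,j) + d(j,m) - d(i,m)` for the way right and 0 for the way up. The sum is `2 d(i,j)`.
    geodesic : ∀ {i j : Fin (suc m)} → i Fin.≤ j →
               Σ[ p ∈ Walk (firstRow i) (firstRow j) ] weightOf p ≤ d (toℕ i) (toℕ j)
    geodesic {i} {j} i≤j with downWalk i j | rightWalk j i≤j ℕ.≤-refl | downWalk j j
    ... | p , down | q , right | r , up = p ∙ q ∙ reverse r ,
      ≤-trans (≤-reflexive weight≈) (double-cancel-≤ (≤-from
        (≤-reflexive (+-cong (+-cong (+-cong down′ right) up′)
                             (≈-sym (+-cong (diagonal i′) (diagonal j′)))))
        (solve 8 (λ x y z ii ij jj im jm →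
          (x ⊕ (y ⊕ z)) ⊕ (x ⊕ (y ⊕ z)) ⊕ ((((ij ⊕ im) ⊕ (ij ⊕ jm)) ⊕ (jj ⊕ jm)) ⊕ (ii ⊕ jj)) ⊜
          (ij ⊕ ij) ⊕
            ((((x ⊕ x ⊕ (ii ⊕ jm)) ⊕ (y ⊕ y ⊕ (im ⊕ jj))) ⊕ (z ⊕ z ⊕ (jj ⊕ jm))) ⊕ (id ⊕ id)))
          ≈-refl (weightOf p) (weightOf q) (weightOf r)
          (d i′ i′) (d i′ j′) (d j′ j′) (d i′ m) (d j′ m))))
      where
      i′ = toℕ i
      j′ = toℕ j
      down′ : VerticalMove i′ i′ j′ (weightOf p)
      down′ = subst (λ a → VerticalMove i′ i′ a (weightOf p)) (ℕ.m≥n⇒m⊔n≡m i≤j) down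
      up′ : VerticalMove j′ j′ j′ (weightOf r)
      up′ = subst (λ a → VerticalMove j′ j′ a (weightOf r)) (ℕ.⊔-idem j′) up
      weight≈ : weightOf (p ∙ q ∙ reverse r) ≈ weightOf p + (weightOf q + weightOf r)
      weight≈ = ≈-trans (weightOf-∙ p _)
        (+-congˡ (≈-trans (weightOf-∙ q _) (+-congˡ (weightOf-reverse r))))

    grid-distance : ∀ {i j : Fin (suc m)} → i Fin.≤ j →
                    IsDistance F grid (firstRow i) (firstRow j) (d (toℕ i) (toℕ j))
    grid-distance i≤j = let p , p≤d = geodesic i≤j in isDistance p p≤d (walk-bound i≤j)

-- Distances within the first row

module FirstRow {c ℓ₁ ℓ₂} (F : OrderedField c ℓ₁ ℓ₂) {m h : ℕ} (G : WeightedGrid F (suc m) (suc h)) where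
  open Arithmetic F
  open Distance F G

  -- Any walk would do: it is the one that `lightestWalk` starts from.
  rowWalk : (i j : Fin (suc m)) → Walk {suc m} {suc h} (firstRow i) (firstRow j)
  rowWalk i j = reverse (fromZero i) ∙ fromZero j
    where
    fromZero : ∀ i → Walk {suc m} {suc h} (zero , zero) (zero , i)
    fromZero = <-weakInduction (λ i → Walk (zero , zero) (zero , i)) stop
      (λ c p → p ∙ step (horizontal zero c) (rightward zero c) stop)

  shortest : (i j : Fin (suc m)) → Walk {suc m} {suc h} (firstRow i) (firstRow j)
  shortest i j = proj₁ (lightestWalk (rowWalk i j))

  dist : Fin (suc m) → Fin (suc m) → Carrier
  dist i j = weightOf (shortest i j)

  dist-minimal : ∀ i j (p : Walk (firstRow i) (firstRow j)) → dist i j ≤ weightOf p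
  dist-minimal i j = proj₂ (lightestWalk (rowWalk i j))

  dist-isDistance : ∀ i j → IsDistance F G (firstRow i) (firstRow j) (dist i j)
  dist-isDistance i j = isDistance (shortest i j) ≤-refl (dist-minimal i j)

  dist-diagonal : ∀ i → dist i i ≈ 0#
  dist-diagonal i = antisym (dist-minimal i i stop) (weightOf-nonNegative (shortest i i))

  -- Both shortest walks are cut at a common vertex `x`. Recombining the four pieces joins the other
  -- pairs of terminals at the same total weight.
  dist-cross : ∀ {i j k l} → i Fin.≤ j → j Fin.≤ k → k Fin.≤ l →
               dist i j + dist k l ≤ dist i k + dist j l × dist i l + dist j k ≤ dist i k + dist j l
  dist-cross {i} {j} {k} {l} i≤j j≤k k≤l
    with walks-cross i≤j j≤k k≤l (shortest i k) (shortest j l)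
  ... | x , x∈p , x∈q with split (shortest i k) x∈p | split (shortest j l) x∈q
  ...   | p₁ , p₂ , p≡ | q₁ , q₂ , q≡ =
    ≤-trans (+-mono-≤ (dist-minimal i j (p₁ ∙ reverse q₁)) (dist-minimal k l (reverse p₂ ∙ q₂)))
      (≤-reflexive (≈-trans
        (+-cong (≈-trans (weightOf-∙ p₁ _) (+-congˡ (weightOf-reverse q₁)))
                (≈-trans (weightOf-∙ (reverse p₂) q₂) (+-congʳ (weightOf-reverse p₂))))
        (≈-trans (solve 4 (λ p₁ p₂ q₁ q₂ → p₁ ⊕ q₁ ⊕ (p₂ ⊕ q₂) ⊜ p₁ ⊕ p₂ ⊕ (q₁ ⊕ q₂)) ≈-refl
          (weightOf p₁) (weightOf p₂) (weightOf q₁) (weightOf q₂)) total≈))) ,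
    ≤-trans (+-mono-≤ (dist-minimal i l (p₁ ∙ q₂)) (dist-minimal j k (q₁ ∙ p₂)))
      (≤-reflexive (≈-trans (+-cong (weightOf-∙ p₁ q₂) (weightOf-∙ q₁ p₂))
        (≈-trans (solve 4 (λ p₁ p₂ q₁ q₂ → p₁ ⊕ q₂ ⊕ (q₁ ⊕ p₂) ⊜ p₁ ⊕ p₂ ⊕ (q₁ ⊕ q₂)) ≈-refl
          (weightOf p₁) (weightOf p₂) (weightOf q₁) (weightOf q₂)) total≈)))
    where
    total≈ : weightOf p₁ + weightOf p₂ + (weightOf q₁ + weightOf q₂) ≈ dist i k + dist j l
    total≈ = ≈-sym (+-cong
      (≈-trans (≡⇒≈ (cong weightOf p≡)) (weightOf-∙ p₁ p₂))
      (≈-trans (≡⇒≈ (cong weightOf q≡)) (weightOf-∙ q₁ q₂)))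
      where
      ≡⇒≈ : ∀ {x y} → x ≡ y → x ≈ y
      ≡⇒≈ refl = ≈-refl

-- Extends the distances to indices in ℕ, where _⊔_ and _⊓_ are available.
clamp : ∀ m → ℕ → Fin (suc m)
clamp zero    _       = zero
clamp (suc m) zero    = zero
clamp (suc m) (suc n) = suc (clamp m n)

clamp-mono-≤ : ∀ m {i j} → i ℕ.≤ j → clamp m i Fin.≤ clamp m j
clamp-mono-≤ zero    _         = z≤n
clamp-mono-≤ (suc m) z≤n       = z≤n
clamp-mono-≤ (suc m) (s≤s i≤j) = s≤s (clamp-mono-≤ m i≤j)

clamp-toℕ : ∀ {m} (i : Fin (suc m)) → clamp m (toℕ i) ≡ i
clamp-toℕ {zero}  zero    = refl
clamp-toℕ {suc m} zero    = refl
clamp-toℕ {suc m} (suc i) = cong suc (clamp-toℕ i)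

open import Data.Nat.Base using (_*_; _^_; _≤_)

-- The new grid is square, so the depth to be bounded is the width `n` itself, and
-- `4 ≤ 2 ^ 4 ≤ n ^ 4`.
4*n≤n^5 : ∀ n → 2 ≤ n → 4 * n ≤ n ^ 5
4*n≤n^5 n 2≤n = begin
  4 * n      ≡⟨ ℕ.*-comm 4 n ⟩
  n * 4      ≤⟨ ℕ.*-monoʳ-≤ n (ℕ.m≤m+n 4 12) ⟩
  n * 2 ^ 4  ≤⟨ ℕ.*-monoʳ-≤ n (ℕ.^-monoˡ-≤ 4 2≤n) ⟩
  n ^ 5      ∎
  where open ℕ.≤-Reasoning

lemma9 : ∀ {c ℓ₁ ℓ₂} (F : OrderedField c ℓ₁ ℓ₂) (ω : ℕ) → 2 ≤ ω →
    (h : ℕ) (G : WeightedGrid F ω (suc h)) →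
    ∃[ h′ ] 4 * suc h′ ≤ ω ^ 5 × (Σ[ G′ ∈ WeightedGrid F ω (suc h′) ]
    (∀ (i j : Fin ω) → i Fin.≤ j →
    SameDistance F G G′ (firstRow i) (firstRow j) (firstRow i) (firstRow j)))
lemma9 F (suc m) 2≤ω h G = m , 4*n≤n^5 (suc m) 2≤ω , grid , λ i j i≤j →
  dist i j , dist-isDistance i j ,
  subst₂ (λ i′ j′ → IsDistance F grid (firstRow i) (firstRow j) (dist i′ j′))
    (clamp-toℕ i) (clamp-toℕ j) (grid-distance i≤j)
  where
  open FirstRow F G
  cross : ∀ {i j k l} → i ≤ j → j ≤ k → k ≤ l → _
  cross i≤j j≤k k≤l = dist-cross (clamp-mono-≤ m i≤j) (clamp-mono-≤ m j≤k) (clamp-mono-≤ m k≤l)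
  open Emulator F (λ i j → dist (clamp m i) (clamp m j)) (λ i → dist-diagonal (clamp m i))
    (λ i≤j j≤k k≤l → proj₁ (cross i≤j j≤k k≤l)) (λ i≤j j≤k k≤l → proj₂ (cross i≤j j≤k k≤l)) m
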